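{- For all integers $0\le r\le n$, \[ \log s(n,r) \le \frac{1}{n-r+1}\binom{n}{r}\log(n-r+2). \]
   Context: $s(n,r)$ denotes the number of sparse paving matroids of rank $r$ on the ground set $[n]=\{1,\dots,n\}$. A matroid of rank $r$ is sparse paving if every $r$-subset of the ground set is either a basis or a circuit-hyperplane (equivalently, the matroid and its dual are both paving, where paving means every circuit has at least $r$ elements). $\log$ is the logarithm to base $2$. -}

module Defs where

open import Data.Bool.Base using (Bool; true; false; T)
open import Data.Bool.Properties using (T?)
open import Data.Fin.Base using (Fin)
open import Data.Fin.Properties using (any?; all?)
open import Data.Fin.Subset
  using (Subset; _∈_; _∉_; _⊆_; _⊂_; _∪_; _-_; ⁅_⁆; ⊤; ∣_∣)
open import Data.Fin.Subset.Properties using (_∈?_; _⊆?_; _⊂?_; anySubset?)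
open import Data.Integer.Base using (+_; -[1+_])
open import Data.List.Base
  using (List; []; _∷_; _++_; length; map; filter; cartesianProductWith)
open import Data.List.Extrema.Nat using (max)
open import Data.Nat.Base using (ℕ; zero; suc)
import Data.Nat.Base as ℕ
import Data.Nat.Properties as ℕ
open import Data.Product.Base using (_×_; _,_; ∃; proj₁; proj₂)
open import Data.Rational.Unnormalised.Base using (ℚᵘ; mkℚᵘ; _<_; _*_; NonNegative)
open import Data.Rational.Unnormalised.Properties using (<-dense; <-trans)
open import Data.Sum.Base using (_⊎_)
open import Data.Vec.Base using ([]; _∷_)
open import Relation.Binary.PropositionalEquality.Core using (_≡_)
open import Relation.Nullary using (Dec; ¬_; ¬?)
open import Relation.Nullary.Decidable
  using (map′; decidable-stable; _×-dec_; _⊎-dec_; _→-dec_)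
open import Relation.Unary using (Decidable)

------------------------------------------------------------------------
-- Real numbers and the binary logarithm

-- An extended real number x, given by its lower cut { q ∈ ℚ ∣ q < x }.
-- The empty cut is -∞ and the full cut is +∞.

record LowerReal : Set₁ where
  field
    Below   : ℚᵘ → Set
    closed  : ∀ {p q} → p < q → Below q → Below p
    rounded : ∀ {p} → Below p → ∃ λ q → p < q × Below q

open LowerReal public

infix 4 _≤ʳ_

_≤ʳ_ : LowerReal → LowerReal → Set
x ≤ʳ y = ∀ q → Below x q → Below y q

sup : (ℚᵘ → Set) → LowerReal
sup S .Below q = ∃ λ p → S p × q < p
sup S .closed p<q (t , t∈S , q<t) = t , t∈S , <-trans p<q q<t
sup S .rounded (t , t∈S , p<t) with <-dense p<t
... | m , p<m , m<t = m , p<m , t , t∈S , m<t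

-- The inequality 2^q ≤ x for rational q = a/b with b = suc d, after raising
-- both sides to the power b and clearing a negative power of 2.

2^_≤_ : ℚᵘ → ℕ → Set
2^ mkℚᵘ (+ a)    d ≤ x = 2 ℕ.^ a ℕ.≤ x ℕ.^ suc d
2^ mkℚᵘ -[1+ a ] d ≤ x = 1 ℕ.≤ 2 ℕ.^ suc a ℕ.* x ℕ.^ suc d

-- log₂ 0 is -∞.

log₂ : ℕ → LowerReal
log₂ x = sup (λ q → 2^ q ≤ x)

-- For c ≥ 0 the lower cut of c x is { q ∣ q < c p for some rational p < x }.

infixr 7 _·_

_·_ : (c : ℚᵘ) .{{_ : NonNegative c}} → LowerReal → LowerReal
(c · x) .Below q = ∃ λ p → Below x p × q < c * p
(c · x) .closed p<q (t , t<x , q<ct) = t , t<x , <-trans p<q q<ct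
(c · x) .rounded (t , t<x , p<ct) with <-dense p<ct
... | m , p<m , m<ct = m , p<m , t , t<x , m<ct

------------------------------------------------------------------------
-- Matroids on Fin n, given by their bases

Family : ℕ → Set
Family n = Subset n → Bool

subsets : ∀ n → List (Subset n)
subsets zero    = [] ∷ []
subsets (suc n) = map (false ∷_) (subsets n) ++ map (true ∷_) (subsets n)

allSubsets? : ∀ {n} {P : Subset n → Set} → Decidable P → Dec (∀ X → P X)
allSubsets? P? = map′
  (λ none X → decidable-stable (P? X) (λ ¬p → none (X , ¬p)))
  (λ all (X , ¬p) → ¬p (all X))
  (¬? (anySubset? (λ X → ¬? (P? X))))

module _ {n : ℕ} (𝓑 : Family n) where

  Basis : Subset n → Set
  Basis B = T (𝓑 B)

  Exchange : Set
  Exchange = ∀ A B → Basis A → Basis B → ∀ x → x ∈ A → x ∉ B →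
             ∃ λ y → y ∈ B × y ∉ A × Basis ((A - x) ∪ ⁅ y ⁆)

  IsMatroid : Set
  IsMatroid = ∃ Basis × Exchange

  Independent : Subset n → Set
  Independent I = ∃ λ B → Basis B × I ⊆ B

  Circuit : Subset n → Set
  Circuit C = ¬ Independent C × (∀ D → D ⊂ C → Independent D)

  basis? : Decidable Basis
  basis? B = T? (𝓑 B)

  independent? : Decidable Independent
  independent? I = anySubset? (λ B → basis? B ×-dec I ⊆? B)

  rank : Subset n → ℕ
  rank X = max 0 (map ∣_∣ (filter (λ I → independent? I ×-dec I ⊆? X) (subsets n)))

  Flat : Subset n → Set
  Flat F = ∀ x → x ∉ F → rank F ℕ.< rank (F ∪ ⁅ x ⁆)

  Hyperplane : Subset n → Set
  Hyperplane H = Flat H × suc (rank H) ≡ rank ⊤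

  IsSparsePaving : ℕ → Set
  IsSparsePaving r =
    IsMatroid × rank ⊤ ≡ r ×
    (∀ X → ∣ X ∣ ≡ r → Basis X ⊎ (Circuit X × Hyperplane X))

  exchange? : Dec Exchange
  exchange? = allSubsets? λ A → allSubsets? λ B →
    basis? A →-dec (basis? B →-dec
      all? λ x → (x ∈? A) →-dec (¬? (x ∈? B) →-dec
        any? λ y → (y ∈? B) ×-dec (¬? (y ∈? A) ×-dec basis? ((A - x) ∪ ⁅ y ⁆))))

  isMatroid? : Dec IsMatroid
  isMatroid? = anySubset? basis? ×-dec exchange?

  circuit? : Decidable Circuit
  circuit? C = ¬? (independent? C) ×-dec
    allSubsets? (λ D → (D ⊂? C) →-dec independent? D)

  hyperplane? : Decidable Hyperplane
  hyperplane? H =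
    all? (λ x → ¬? (x ∈? H) →-dec (rank H ℕ.<? rank (H ∪ ⁅ x ⁆)))
      ×-dec (suc (rank H) ℕ.≟ rank ⊤)

  isSparsePaving? : Decidable IsSparsePaving
  isSparsePaving? r = isMatroid? ×-dec ((rank ⊤ ℕ.≟ r) ×-dec
    allSubsets? (λ X → (∣ X ∣ ℕ.≟ r) →-dec
      (basis? X ⊎-dec (circuit? X ×-dec hyperplane? X))))

------------------------------------------------------------------------
-- Counting

-- Each Boolean function on Subset n occurs in `families n` exactly once, up to
-- pointwise equality: such a function on Subset (suc n) is determined by its
-- restrictions to the subsets avoiding, respectively containing, zero.

glue : ∀ {n} → Family n → Family n → Family (suc n)
glue f g (false ∷ X) = f X
glue f g (true  ∷ X) = g X

families : ∀ n → List (Family n)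
families zero    = (λ _ → false) ∷ (λ _ → true) ∷ []
families (suc n) = cartesianProductWith glue (families n) (families n)

s : ℕ → ℕ → ℕ
s n r = length (filter (λ 𝓑 → isSparsePaving? 𝓑 r) (families n))

{-# OPTIONS --safe #-}
-- In a sparse paving matroid of rank r two non-bases of size r never meet in r − 1
-- elements: such a common part Y lies in a basis Y ∪ {w}, and, the non-bases being
-- hyperplanes, some basis lies in their union; exchanging w into that basis turns one
-- of the two non-bases into a basis. Hence for each (r − 1)-set Y at most one of the
-- n − r + 1 r-sets above Y is a non-basis, which leaves n − r + 2 possibilities there.
-- Every r-set lies above exactly r sets Y, so Shearer's lemma gives
-- s(n,r)^r ≤ (n − r + 2)^C(n,r−1), and (n − r + 1) C(n,r−1) = r C(n,r).
module Submission where

open import Defs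
open import Data.Bool.Base using (Bool; true; false; T)
open import Data.Bool.Properties using (¬-not; T-≡)
import Data.Bool.Properties as Bool
open import Data.Fin.Base using (zero; suc)
open import Data.Fin.Properties using (any?)
open import Data.Fin.Subset
  using (Subset; _∈_; _∉_; _⊆_; _⊂_; _∪_; _∩_; ∁; _-_; ⁅_⁆; ∣_∣; ⊤; ⊥)
open import Data.Fin.Subset.Properties
open import Data.Integer.Base using (+_; -[1+_])
import Data.Integer.Properties as ℤ
open import Data.List.Base using (List; []; _∷_; _++_; length; map; filter)
open import Data.List.Extrema.Nat using (xs≤max; argmax-sel)
import Data.List.Membership.Propositional as List
open import Data.List.Membership.Propositional.Properties
  using (∈-++⁺ˡ; ∈-++⁺ʳ; ∈-map⁺; ∈-map⁻; ∈-filter⁺; ∈-filter⁻)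
open import Data.List.Properties
  using (length-map; length-++; filter-++; filter-≐; filter-none; filter-accept; filter-reject)
open import Data.List.Relation.Binary.Disjoint.Propositional using (Disjoint)
import Data.List.Relation.Binary.Subset.Propositional as List
open import Data.List.Relation.Binary.Subset.Propositional.Properties using (filter-⊆)
open import Data.List.Relation.Unary.All as All using (All; []; _∷_)
open import Data.List.Relation.Unary.All.Properties using (all-filter)
import Data.List.Relation.Unary.All.Properties as All
open import Data.List.Relation.Unary.AllPairs as AllPairs using (AllPairs; []; _∷_)
import Data.List.Relation.Unary.AllPairs.Properties as AllPairs
open import Data.List.Relation.Unary.Any using (here)
open import Data.List.Relation.Unary.Unique.Propositional using (Unique)
import Data.List.Relation.Unary.Unique.Propositional.Properties as Unique
import Data.List.Relation.Unary.Unique.Setoid as Setoid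
import Data.List.Relation.Unary.Unique.Setoid.Properties as Setoid
open import Data.Nat.Base hiding (∣_-_∣; _/_)
open import Data.Nat.Combinatorics
  using (_C_; nCk+nC[k+1]≡[n+1]C[k+1]; nCk≡nC[n∸k]; nC1≡n; nCn≡1; k>n⇒nCk≡0)
open import Data.Nat.ListAction using (product)
open import Data.Nat.Properties
open import Data.Nat.Tactic.RingSolver using (solve-∀)
open import Data.Product.Base using (_×_; _,_; ∃; proj₁; proj₂)
open import Data.Rational.Unnormalised.Base as ℚᵘ using (mkℚᵘ; _/_)
import Data.Rational.Unnormalised.Properties as ℚᵘ
open import Data.Sum.Base using (_⊎_; inj₁; inj₂; [_,_]′)
open import Data.Vec.Base using ([]; _∷_; here; there)
open import Function.Base using (_∘_; id)
open import Function.Bundles using (Equivalence)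
open import Relation.Binary.PropositionalEquality
  using (_≡_; refl; sym; trans; cong; cong₂; subst; subst₂; _→-setoid_)
open import Relation.Nullary using (¬_; ¬?; yes; no; does; contradiction; _×-dec_; decidable-stable)
open import Relation.Unary using (Decidable)
open ≤-Reasoning

-- Inequalities in ℕ

-- Roots and entropies leave the natural numbers, so everything before the final passage to
-- logarithms is an inequality between powers in ℕ. Shearer's lemma is taken in its combinatorial
-- form, about numbers of distinct restrictions of a family of Boolean functions, and the families
-- are split at one coordinate at a time. Its analytic content is then Hölder's inequality, which
-- comes from AM-GM with all denominators cleared. The coordinates are the r-sets, and a matroid
-- enters through its values there. Functions are compared only pointwise, so being distinct has to
-- mean differing at some coordinate. For r = 0 there are no (r - 1)-sets, and this rank is treated
-- apart.

^-distribʳ-* : ∀ k a b → (a * b) ^ k ≡ a ^ k * b ^ k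
^-distribʳ-* zero    a b = refl
^-distribʳ-* (suc k) a b rewrite ^-distribʳ-* k a b = interchange a b (a ^ k) (b ^ k)
  where
  interchange : ∀ a b c d → a * b * (c * d) ≡ a * c * (b * d)
  interchange = solve-∀

^-swap : ∀ a m n → (a ^ m) ^ n ≡ (a ^ n) ^ m
^-swap a m n = trans (^-*-assoc a m n) (trans (cong (a ^_) (*-comm m n)) (sym (^-*-assoc a n m)))

^-cancelʳ-≤ : ∀ k .{{_ : NonZero k}} {a b} → a ^ k ≤ b ^ k → a ≤ b
^-cancelʳ-≤ k aᵏ≤bᵏ = ≮⇒≥ (λ b<a → <⇒≱ (^-monoˡ-< k b<a) aᵏ≤bᵏ)

rearrangement : ∀ {a b c d} → a ≤ b → c ≤ d → a * d + b * c ≤ a * c + b * d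
rearrangement {a} {c = c} a≤b c≤d
  with e , refl ← m≤n⇒∃[o]m+o≡n a≤b | f , refl ← m≤n⇒∃[o]m+o≡n c≤d = begin
  a * (c + f) + (a + e) * c          ≤⟨ m≤m+n _ (e * f) ⟩
  a * (c + f) + (a + e) * c + e * f  ≡⟨ expand a c e f ⟩
  a * c + (a + e) * (c + f)          ∎
  where
  expand : ∀ a c e f → a * (c + f) + (a + e) * c + e * f ≡ a * c + (a + e) * (c + f)
  expand = solve-∀

-- The case of AM-GM with k weights on v and one on w.
young : ∀ k w v → suc k * (w * v ^ k) ≤ w ^ suc k + k * v ^ suc k
young zero    w v = ≤-reflexive (lemma w)
  where
  lemma : ∀ w → 1 * (w * 1) ≡ w * 1 + 0
  lemma = solve-∀
young (suc k) w v = begin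
  suc (suc k) * (w * (v * v ^ k))                              ≡⟨ lemma₁ k w v (v ^ k) ⟩
  v * (suc k * (w * v ^ k)) + w * v ^ suc k                    ≤⟨ +-monoˡ-≤ _ (*-monoʳ-≤ v (young k w v)) ⟩
  v * (w ^ suc k + k * v ^ suc k) + w * v ^ suc k              ≡⟨ lemma₂ k w v (w ^ suc k) (v ^ suc k) ⟩
  (v * w ^ suc k + w * v ^ suc k) + k * (v * v ^ suc k)        ≤⟨ +-monoˡ-≤ _ cross ⟩
  (w * w ^ suc k + v * v ^ suc k) + k * (v * v ^ suc k)        ≡⟨ +-assoc (w ^ suc (suc k)) _ _ ⟩
  w * w ^ suc k + suc k * (v * v ^ suc k)                      ∎
  where
  lemma₁ : ∀ k w v V → suc (suc k) * (w * (v * V)) ≡ v * (suc k * (w * V)) + w * (v * V)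
  lemma₁ = solve-∀
  lemma₂ : ∀ k w v W V → v * (W + k * V) + w * V ≡ (v * W + w * V) + k * (v * V)
  lemma₂ = solve-∀
  -- Powers preserve order, so `w`, `v` and their powers are sorted alike and rearrangement applies
  -- in either order.
  cross : v * w ^ suc k + w * v ^ suc k ≤ w * w ^ suc k + v * v ^ suc k
  cross with ≤-total v w
  ... | inj₁ v≤w = ≤-trans (rearrangement v≤w (^-monoˡ-≤ (suc k) v≤w)) (≤-reflexive (+-comm (v ^ suc (suc k)) _))
  ... | inj₂ w≤v = ≤-trans (≤-reflexive (+-comm (v * w ^ suc k) _)) (rearrangement w≤v (^-monoˡ-≤ (suc k) w≤v))

-- This is AM-GM for `u` and `k` copies of t/k. The values `w` and `v` are k(k + 1) times the mean
-- of all k + 1 numbers and the mean of the `k` copies; `young` compares the two, and the term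
-- `k * v ^ suc k` cancels.
amgm-step-pos : ∀ k .{{_ : NonZero k}} u t → suc k ^ suc k * (u * t ^ k) ≤ k ^ k * (u + t) ^ suc k
amgm-step-pos k u t = *-cancelˡ-≤ k (+-cancelʳ-≤ (k * v ^ suc k) _ _ (begin
  k * (suc k ^ suc k * (u * t ^ k)) + k * (v * v ^ k)
    ≡⟨ cong (λ z → k * (suc k ^ suc k * (u * t ^ k)) + k * (v * z)) (^-distribʳ-* k (suc k) t) ⟩
  k * (suc k ^ suc k * (u * t ^ k)) + k * (v * (suc k ^ k * t ^ k))
    ≡⟨ lemma k u t (suc k ^ k) (t ^ k) ⟩
  suc k * (w * (suc k ^ k * t ^ k))
    ≡⟨ cong (λ z → suc k * (w * z)) (^-distribʳ-* k (suc k) t) ⟨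
  suc k * (w * v ^ k)
    ≤⟨ young k w v ⟩
  w ^ suc k + k * v ^ suc k
    ≡⟨ cong (_+ k * v ^ suc k) (trans (^-distribʳ-* (suc k) k (u + t)) (*-assoc k (k ^ k) _)) ⟩
  k * (k ^ k * (u + t) ^ suc k) + k * v ^ suc k ∎))
  where
  w = k * (u + t)
  v = suc k * t
  lemma : ∀ k u t K T → k * (suc k * K * (u * T)) + k * (suc k * t * (K * T)) ≡ suc k * (k * (u + t) * (K * T))
  lemma = solve-∀

amgm-step : ∀ k u t → suc k ^ suc k * (u * t ^ k) ≤ k ^ k * (u + t) ^ suc k
amgm-step zero    u t = begin
  1 * (u * 1)        ≡⟨ trans (*-identityˡ (u * 1)) (*-identityʳ u) ⟩
  u                  ≤⟨ m≤m+n u t ⟩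
  u + t              ≡⟨ trans (*-identityˡ ((u + t) * 1)) (*-identityʳ (u + t)) ⟨
  1 * ((u + t) * 1)  ∎
amgm-step k@(suc _) u t = amgm-step-pos k u t

-- AM-GM and Hölder's inequality for products over a list.

module _ {J : Set} where

  prod : (J → ℕ) → List J → ℕ
  prod f js = product (map f js)

  prod-mono : ∀ {f g : J → ℕ} {js} → All (λ j → f j ≤ g j) js → prod f js ≤ prod g js
  prod-mono []           = ≤-refl
  prod-mono (fj≤gj ∷ ps) = *-mono-≤ fj≤gj (prod-mono ps)

  -- The sum of the ratios a j / p j, multiplied by prod p js.
  ratioSum : (a p : J → ℕ) → List J → ℕ
  ratioSum a p []       = 0
  ratioSum a p (j ∷ js) = a j * prod p js + p j * ratioSum a p js

  -- At each index the two ratios a/(a + b) and b/(a + b) add up to 1.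
  ratioSum-+ : ∀ (a b : J → ℕ) js → let p = λ j → a j + b j in
               ratioSum a p js + ratioSum b p js ≡ length js * prod p js
  ratioSum-+ a b []       = refl
  ratioSum-+ a b (j ∷ js) = trans (lemma₁ (a j) (b j) Q _ _)
    (trans (cong (λ z → p j * Q + p j * z) (ratioSum-+ a b js)) (lemma₂ (a j) (b j) (length js) Q))
    where
    p : J → ℕ
    p j = a j + b j
    Q = prod p js
    lemma₁ : ∀ a b Q A B → a * Q + (a + b) * A + (b * Q + (a + b) * B) ≡ (a + b) * Q + (a + b) * (A + B)
    lemma₁ = solve-∀
    lemma₂ : ∀ a b k Q → (a + b) * Q + (a + b) * (k * Q) ≡ suc k * ((a + b) * Q)
    lemma₂ = solve-∀

  -- AM-GM for the ratios a j / p j, with denominators cleared.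
  amgm : ∀ (a p : J → ℕ) js → let k = length js in
         k ^ k * prod a js * prod p js ^ k ≤ prod p js * ratioSum a p js ^ k
  amgm a p []       = ≤-refl
  -- The factor `k ^ k` is inserted to meet the induction hypothesis. It can be cancelled even for k
  -- = 0, where it is 1.
  amgm a p (j ∷ js) = *-cancelˡ-≤ (k ^ k) {{k^k≢0 k}} (begin
    k ^ k * (suc k ^ suc k * (α * A) * (π * Q) ^ suc k)
      ≡⟨ cong (λ z → k ^ k * (suc k ^ suc k * (α * A) * (π * Q * z))) (^-distribʳ-* k π Q) ⟩
    k ^ k * (suc k ^ suc k * (α * A) * (π * Q * (π ^ k * Q ^ k)))
      ≡⟨ lemma₁ (k ^ k) (suc k ^ suc k) α A π Q (π ^ k) (Q ^ k) ⟩
    suc k ^ suc k * α * π * Q * π ^ k * (k ^ k * A * Q ^ k)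
      ≤⟨ *-monoʳ-≤ (suc k ^ suc k * α * π * Q * π ^ k) (amgm a p js) ⟩
    suc k ^ suc k * α * π * Q * π ^ k * (Q * U ^ k)
      ≡⟨ lemma₂ (suc k ^ suc k) α π Q (π ^ k) (U ^ k) ⟩
    π * Q * (suc k ^ suc k * (α * Q * (π ^ k * U ^ k)))
      ≡⟨ cong (λ z → π * Q * (suc k ^ suc k * (α * Q * z))) (^-distribʳ-* k π U) ⟨
    π * Q * (suc k ^ suc k * (α * Q * (π * U) ^ k))
      -- The two arguments are the summands of the ratio sum over `j ∷ js`: the new ratio and the
      -- old ones.
      ≤⟨ *-monoʳ-≤ (π * Q) (amgm-step k (α * Q) (π * U)) ⟩
    π * Q * (k ^ k * (α * Q + π * U) ^ suc k)
      ≡⟨ lemma₃ (π * Q) (k ^ k) _ ⟩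
    k ^ k * (π * Q * (α * Q + π * U) ^ suc k) ∎)
    where
    k = length js
    α = a j
    π = p j
    A = prod a js
    Q = prod p js
    U = ratioSum a p js
    k^k≢0 : ∀ k → NonZero (k ^ k)
    k^k≢0 zero    = _
    k^k≢0 (suc k) = m^n≢0 (suc k) (suc k)
    lemma₁ : ∀ K L α A π Q π′ Q′ → K * (L * (α * A) * (π * Q * (π′ * Q′))) ≡ L * α * π * Q * π′ * (K * A * Q′)
    lemma₁ = solve-∀
    lemma₂ : ∀ L α π Q π′ U′ → L * α * π * Q * π′ * (Q * U′) ≡ π * Q * (L * (α * Q * (π′ * U′)))
    lemma₂ = solve-∀
    lemma₃ : ∀ x y z → x * (y * z) ≡ y * (x * z)
    lemma₃ = solve-∀

-- With λ the k-th root of D/M, this adds x ≤ λu and y ≤ λv. As λ need not be rational, x/u and y/v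
-- are compared instead: if x/u is at most y/v, then (x + y)/(u + v) is at most y/v as well, and the
-- bound for `y` suffices. A zero `v` forces `y` to vanish.
+-^-bound : ∀ k .{{_ : NonZero k}} {M D x y u v} .{{_ : NonZero M}} →
            x ^ k * M ≤ D * u ^ k → y ^ k * M ≤ D * v ^ k →
            (x + y) ^ k * M ≤ D * (u + v) ^ k
+-^-bound k {M} {D} {x} {y} {u} {v} xu yv = split (≤-total (x * v) (y * u))
  where
  degenerate : ∀ {x y u} → x ^ k * M ≤ D * u ^ k → y ^ k * M ≤ D * 0 ^ k → (x + y) ^ k * M ≤ D * (u + 0) ^ k
  degenerate {x} {y} {u} xu y0 = begin
    (x + y) ^ k * M    ≡⟨ cong (λ z → (x + z) ^ k * M) y≡0 ⟩
    (x + 0) ^ k * M    ≡⟨ cong (λ z → z ^ k * M) (+-identityʳ x) ⟩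
    x ^ k * M          ≤⟨ xu ⟩
    D * u ^ k          ≡⟨ cong (λ z → D * z ^ k) (+-identityʳ u) ⟨
    D * (u + 0) ^ k    ∎
    where
    0^k≡0 : ∀ k .{{_ : NonZero k}} → 0 ^ k ≡ 0
    0^k≡0 (suc _) = refl
    y^k*M≤0 : y ^ k * M ≤ 0 * M
    y^k*M≤0 = ≤-trans y0 (≤-reflexive (trans (cong (D *_) (0^k≡0 k)) (*-zeroʳ D)))
    y≡0 : y ≡ 0
    y≡0 = m^n≡0⇒m≡0 y k (n≤0⇒n≡0 (*-cancelʳ-≤ (y ^ k) 0 M y^k*M≤0))
  regular : ∀ x y u v .{{_ : NonZero v}} → y ^ k * M ≤ D * v ^ k → x * v ≤ y * u →
            (x + y) ^ k * M ≤ D * (u + v) ^ k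
  regular x y u v yv xv≤yu = *-cancelˡ-≤ (v ^ k) {{m^n≢0 v k}} (begin
    v ^ k * ((x + y) ^ k * M)      ≡⟨ lemma₁ (v ^ k) ((x + y) ^ k) M ⟩
    (x + y) ^ k * v ^ k * M        ≡⟨ cong (_* M) (^-distribʳ-* k (x + y) v) ⟨
    ((x + y) * v) ^ k * M          ≤⟨ *-monoˡ-≤ M (^-monoˡ-≤ k base) ⟩
    (y * (u + v)) ^ k * M          ≡⟨ cong (_* M) (^-distribʳ-* k y (u + v)) ⟩
    y ^ k * (u + v) ^ k * M        ≡⟨ lemma₂ (y ^ k) ((u + v) ^ k) M ⟩
    y ^ k * M * (u + v) ^ k        ≤⟨ *-monoˡ-≤ ((u + v) ^ k) yv ⟩
    D * v ^ k * (u + v) ^ k        ≡⟨ lemma₃ D (v ^ k) ((u + v) ^ k) ⟩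
    v ^ k * (D * (u + v) ^ k)      ∎)
    where
    base : (x + y) * v ≤ y * (u + v)
    base = begin
      (x + y) * v    ≡⟨ *-distribʳ-+ v x y ⟩
      x * v + y * v  ≤⟨ +-monoˡ-≤ (y * v) xv≤yu ⟩
      y * u + y * v  ≡⟨ *-distribˡ-+ y u v ⟨
      y * (u + v)    ∎
    lemma₁ : ∀ a b c → a * (b * c) ≡ b * a * c
    lemma₁ = solve-∀
    lemma₂ : ∀ a b c → a * b * c ≡ a * c * b
    lemma₂ = solve-∀
    lemma₃ : ∀ a b c → a * b * c ≡ b * (a * c)
    lemma₃ = solve-∀
  ordered : ∀ x y u v → x ^ k * M ≤ D * u ^ k → y ^ k * M ≤ D * v ^ k → x * v ≤ y * u →
            (x + y) ^ k * M ≤ D * (u + v) ^ k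
  ordered x y u zero      xu yv _     = degenerate {x} {y} {u} xu yv
  ordered x y u v@(suc _) xu yv xv≤yu = regular x y u v yv xv≤yu
  split : x * v ≤ y * u ⊎ y * u ≤ x * v → (x + y) ^ k * M ≤ D * (u + v) ^ k
  split (inj₁ xv≤yu) = ordered x y u v xu yv xv≤yu
  split (inj₂ yu≤xv) = begin
    (x + y) ^ k * M  ≡⟨ cong (λ z → z ^ k * M) (+-comm x y) ⟩
    (y + x) ^ k * M  ≤⟨ ordered y x v u yv xu yu≤xv ⟩
    D * (v + u) ^ k  ≡⟨ cong (λ z → D * z ^ k) (+-comm v u) ⟩
    D * (u + v) ^ k  ∎

-- Divide by the product of the a + b. By AM-GM the geometric mean of the ratios a/(a + b) is at
-- most their arithmetic mean, likewise for b/(a + b), and the two arithmetic means add up to 1. The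
-- constant `c` leaves room for factors that are not split.
hölder : ∀ {J : Set} (a b : J → ℕ) js .{{_ : NonZero (length js)}} {c x y} →
         x ^ length js ≤ c * prod a js → y ^ length js ≤ c * prod b js →
         (x + y) ^ length js ≤ c * prod (λ j → a j + b j) js
hölder a b js {c} {x} {y} xa yb with prod (λ j → a j + b j) js in Q≡
-- Here division by the product is impossible, but the products of the `a` and of the `b` are
-- smaller still, so `x` and `y` are both 0.
... | zero = ≤-trans (≤-reflexive (cong₂ (λ x y → (x + y) ^ length js) x≡0 y≡0)) 0^k≤
  where
  k = length js
  vanishes : ∀ {d z} → (∀ j → d j ≤ a j + b j) → z ^ k ≤ c * prod d js → z ≡ 0
  vanishes {d} {z} d≤ le = m^n≡0⇒m≡0 z k (n≤0⇒n≡0 (begin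
    z ^ k                          ≤⟨ le ⟩
    c * prod d js                  ≤⟨ *-monoʳ-≤ c (prod-mono (All.universal d≤ js)) ⟩
    c * prod (λ j → a j + b j) js  ≡⟨ cong (c *_) Q≡ ⟩
    c * 0                          ≡⟨ *-zeroʳ c ⟩
    0                              ∎))
  x≡0 : x ≡ 0
  x≡0 = vanishes (λ j → m≤m+n (a j) (b j)) xa
  y≡0 : y ≡ 0
  y≡0 = vanishes (λ j → m≤n+m (b j) (a j)) yb
  0^k≤ : ∀ {k} .{{_ : NonZero k}} {m} → 0 ^ k ≤ m
  0^k≤ {suc _} = z≤n
-- In `M` the factor `k` clears the arithmetic mean and `Q` clears the ratios.
... | Q@(suc _) = *-cancelʳ-≤ _ _ M {{M≢0}} (begin
  (x + y) ^ k * M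
    ≤⟨ +-^-bound k {M} {c * Q} {x} {y} {{M≢0}} (scaled a x xa) (scaled b y yb) ⟩
  c * Q * (ratioSum a p js + ratioSum b p js) ^ k
    ≡⟨ cong (λ z → c * Q * z ^ k) (ratioSum-+ a b js) ⟩
  c * Q * (k * prod p js) ^ k
    ≡⟨ cong (λ z → c * Q * (k * z) ^ k) Q≡ ⟩
  c * Q * M ∎)
  where
  k = length js
  p : _ → ℕ
  p j = a j + b j
  M = (k * Q) ^ k
  M≢0 : NonZero M
  M≢0 = m^n≢0 (k * Q) k {{m*n≢0 k Q}}
  lemma₁ : ∀ x K Q → x * (K * Q) ≡ K * Q * x
  lemma₁ = solve-∀
  lemma₂ : ∀ K Q c A → K * Q * (c * A) ≡ c * (K * A * Q)
  lemma₂ = solve-∀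
  scaled : ∀ d z → z ^ k ≤ c * prod d js → z ^ k * M ≤ c * Q * ratioSum d p js ^ k
  scaled d z le = begin
    z ^ k * M                              ≡⟨ cong (z ^ k *_) (^-distribʳ-* k k Q) ⟩
    z ^ k * (k ^ k * Q ^ k)                ≡⟨ lemma₁ (z ^ k) (k ^ k) (Q ^ k) ⟩
    k ^ k * Q ^ k * z ^ k                  ≤⟨ *-monoʳ-≤ (k ^ k * Q ^ k) le ⟩
    k ^ k * Q ^ k * (c * prod d js)        ≡⟨ lemma₂ (k ^ k) (Q ^ k) c _ ⟩
    c * (k ^ k * prod d js * Q ^ k)        ≤⟨ *-monoʳ-≤ c amgm-Q ⟩
    c * (Q * ratioSum d p js ^ k)          ≡⟨ *-assoc c Q _ ⟨
    c * Q * ratioSum d p js ^ k            ∎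
    where
    amgm-Q : k ^ k * prod d js * Q ^ k ≤ Q * ratioSum d p js ^ k
    amgm-Q = subst (λ q → k ^ k * prod d js * q ^ k ≤ q * ratioSum d p js ^ k) Q≡ (amgm d p js)

prod-const : ∀ {J : Set} c (js : List J) → prod (λ _ → c) js ≡ c ^ length js
prod-const c []       = refl
prod-const c (_ ∷ js) = cong (c *_) (prod-const c js)

prod-filter : ∀ {J : Set} {P : J → Set} (P? : Decidable P) f js →
              prod f js ≡ prod f (filter (¬? ∘ P?) js) * prod f (filter P? js)
prod-filter P? f [] = refl
prod-filter P? f (j ∷ js) rewrite prod-filter P? f js with does (P? j)
... | true  = lemma (f j) (prod f (filter (¬? ∘ P?) js)) (prod f (filter P? js))
  where
  lemma : ∀ a b c → a * (b * c) ≡ b * (a * c)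
  lemma = solve-∀
... | false = sym (*-assoc (f j) _ _)

-- Shearer's lemma

All⇒AllPairs : ∀ {A : Set} {P : A → Set} {xs} → All P xs → AllPairs (λ x y → P x × P y) xs
All⇒AllPairs []         = []
All⇒AllPairs (px ∷ pxs) = All.map (px ,_) pxs ∷ All⇒AllPairs pxs

module _ {X : Set} where

  fibre : X → Bool → List (X → Bool) → List (X → Bool)
  fibre i b F = filter (λ f → f i Bool.≟ b) F

  -- The number of distinct restrictions to A of members of F.
  traces : List X → List (X → Bool) → ℕ
  traces []      []      = 0
  traces []      (_ ∷ _) = 1
  traces (i ∷ A) F       = traces A (fibre i true F) + traces A (fibre i false F)

  traces-mono : ∀ A {F G} → F List.⊆ G → traces A F ≤ traces A G
  traces-mono []      {[]}            F⊆G = z≤n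
  traces-mono []      {_ ∷ _} {[]}    F⊆G with () ← F⊆G (here refl)
  traces-mono []      {_ ∷ _} {_ ∷ _} F⊆G = ≤-refl
  traces-mono (i ∷ A) {F} {G} F⊆G = +-mono-≤ (traces-mono A (part true)) (traces-mono A (part false))
    where
    part : ∀ b → fibre i b F List.⊆ fibre i b G
    part b f∈ with f∈F , fi≡b ← ∈-filter⁻ (λ f → f i Bool.≟ b) {xs = F} f∈ =
      ∈-filter⁺ (λ f → f i Bool.≟ b) (F⊆G f∈F) fi≡b

  length-split : ∀ F i → length F ≡ length (fibre i true F) + length (fibre i false F)
  length-split []      i = refl
  length-split (f ∷ F) i with f i
  ... | true  = cong suc (length-split F i)
  ... | false = trans (cong suc (length-split F i)) (sym (+-suc _ _))

  -- Members of one fibre agree at `i`, so they must be told apart on the rest of `I`. When no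
  -- coordinate is left, nothing can separate two members, hence at most one remains.
  length≤traces : ∀ I {F} → AllPairs (λ f g → ¬ All (λ i → f i ≡ g i) I) F → length F ≤ traces I F
  length≤traces []      []                 = z≤n
  length≤traces []      ([] ∷ _)           = ≤-refl
  length≤traces []      ((distinct ∷ _) ∷ _) = contradiction [] distinct
  length≤traces (i ∷ I) {F} distinct = begin
    length F                                                ≡⟨ length-split F i ⟩
    length (fibre i true F) + length (fibre i false F)      ≤⟨ +-mono-≤ (part true) (part false) ⟩
    traces I (fibre i true F) + traces I (fibre i false F)  ∎
    where
    part : ∀ b → length (fibre i b F) ≤ traces I (fibre i b F)
    part b = length≤traces I (AllPairs.zipWith
      (λ (f≢g , fi≡b , gi≡b) f≡g → f≢g (trans fi≡b (sym gi≡b) ∷ f≡g))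
      ( AllPairs.filter⁺ (λ f → f i Bool.≟ b) distinct
      , All⇒AllPairs (all-filter (λ f → f i Bool.≟ b) F)))

  traces-[] : ∀ A → traces A [] ≡ 0
  traces-[] []      = refl
  traces-[] (_ ∷ A) = cong₂ _+_ (traces-[] A) (traces-[] A)

  traces≤1 : ∀ A {F} → All (λ f → All (λ i → f i ≡ true) A) F → traces A F ≤ 1
  traces≤1 []      {[]}    _ = z≤n
  traces≤1 []      {_ ∷ _} _ = ≤-refl
  traces≤1 (i ∷ A) {F} const = begin
    traces A F₁ + traces A (fibre i false F)  ≡⟨ cong (λ G → traces A F₁ + traces A G) none ⟩
    traces A F₁ + traces A []                 ≡⟨ cong (λ t → traces A F₁ + t) (traces-[] A) ⟩
    traces A F₁ + 0                           ≡⟨ +-identityʳ _ ⟩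
    traces A F₁                               ≤⟨ traces≤1 A (All.filter⁺ (λ f → f i Bool.≟ true) (All.map All.tail const)) ⟩
    1                                         ∎
    where
    F₁ = fibre i true F
    none : fibre i false F ≡ []
    none = filter-none (λ f → f i Bool.≟ false)
      (All.map (λ {(fi≡t ∷ _) fi≡f → contradiction (trans (sym fi≡t) fi≡f) λ ()}) const)

  -- At most one coordinate is false, so the patterns are the constant one and one for each position
  -- of the exception. A false value at `i` fixes all later values, so that fibre contributes at
  -- most 1.
  traces≤suc-length : ∀ A {F} → All (λ f → AllPairs (λ i j → f i ≡ false → f j ≡ true) A) F →
                      traces A F ≤ suc (length A)
  traces≤suc-length []      {[]}    _ = z≤n
  traces≤suc-length []      {_ ∷ _} _ = ≤-refl
  traces≤suc-length (i ∷ A) {F} one = begin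
    traces A (fibre i true F) + traces A (fibre i false F)
      ≤⟨ +-mono-≤ (traces≤suc-length A (All.filter⁺ (λ f → f i Bool.≟ true) (All.map AllPairs.tail one)))
                  (traces≤1 A (All.zipWith (λ {(ps ∷ _ , fi≡f) → All.map (λ p → p fi≡f) ps})
                    (All.filter⁺ (λ f → f i Bool.≟ false) one , all-filter (λ f → f i Bool.≟ false) F))) ⟩
    suc (length A) + 1
      ≡⟨ +-comm (suc (length A)) 1 ⟩
    suc (suc (length A)) ∎

  -- After splitting the family by its values at one coordinate, the bounds for the two
  -- halves recombine by Hölder's inequality.
  shearer : ∀ {J : Set} {R : J → X → Set} (R? : ∀ j → Decidable (R j)) js k .{{_ : NonZero k}} I →
            All (λ i → length (filter (λ j → R? j i) js) ≡ k) I → ∀ F →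
            traces I F ^ k ≤ prod (λ j → traces (filter (R? j) I) F) js
  shearer R? js k@(suc _) [] _ []      = z≤n
  shearer R? js k [] _ (_ ∷ _) = ≤-reflexive (begin-equality
    1 ^ k              ≡⟨ ^-zeroˡ k ⟩
    1                  ≡⟨ ^-zeroˡ (length js) ⟨
    1 ^ length js      ≡⟨ prod-const 1 js ⟨
    prod (λ _ → 1) js  ∎)
  -- Matching on `deg` replaces `k` by the number of index sets through `i`, which is the number of
  -- factors that Hölder's inequality has to combine.
  shearer {J} {R} R? js k (i ∷ I) (deg ∷ degs) F with refl ← deg = begin
    (traces I F₁ + traces I F₀) ^ length on
      -- Index sets avoiding `i` do not see the split. Their traces on either half are at most those
      -- on `F`, and this common bound serves as the constant.
      ≤⟨ hölder (t F₁) (t F₀) on {prod (t F) off} (half true) (half false) ⟩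
    prod (t F) off * prod (λ j → t F₁ j + t F₀ j) on
      ≤⟨ *-mono-≤ (prod-mono (All.map (≤-reflexive ∘ skipped) (all-filter (¬? ∘ at-i) js)))
                  (prod-mono (All.map (≤-reflexive ∘ halved) (all-filter at-i js))) ⟩
    prod c off * prod c on
      ≡⟨ prod-filter at-i c js ⟨
    prod c js ∎
    where
    F₁ = fibre i true F
    F₀ = fibre i false F
    at-i : Decidable (λ j → R j i)
    at-i j = R? j i
    on  = filter at-i js
    off = filter (¬? ∘ at-i) js
    t : List (X → Bool) → J → ℕ
    t G j = traces (filter (R? j) I) G
    c : J → ℕ
    c j = traces (filter (R? j) (i ∷ I)) F
    skipped : ∀ {j} → ¬ R j i → t F j ≡ c j
    skipped {j} ¬Rji = cong (λ A → traces A F) (sym (filter-reject (R? j) ¬Rji))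
    halved : ∀ {j} → R j i → t F₁ j + t F₀ j ≡ c j
    halved {j} Rji = cong (λ A → traces A F) (sym (filter-accept (R? j) Rji))
    half : ∀ b → traces I (fibre i b F) ^ length on ≤ prod (t F) off * prod (t (fibre i b F)) on
    half b = begin
      traces I G ^ length on          ≤⟨ shearer R? js (length on) I degs G ⟩
      prod (t G) js                   ≡⟨ prod-filter at-i (t G) js ⟩
      prod (t G) off * prod (t G) on  ≤⟨ *-monoˡ-≤ (prod (t G) on) (prod-mono (All.universal thinner off)) ⟩
      prod (t F) off * prod (t G) on  ∎
      where
      G = fibre i b F
      thinner : ∀ j → t G j ≤ t F j
      thinner j = traces-mono (filter (R? j) I) (filter-⊆ (λ f → f i Bool.≟ b) F)

-- Counting subsets

private variable
  n k r : ℕ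

nC0≡1 : ∀ n → n C 0 ≡ 1
nC0≡1 n = trans (nCk≡nC[n∸k] {0} {n} z≤n) (nCn≡1 n)

-- C(n,k) (n − k) = (k + 1) C(n,k+1), with the subtraction moved to the other side.
C-absorption : ∀ n k → suc k * (n C suc k) + k * (n C k) ≡ n * (n C k)
C-absorption zero    zero    = refl
C-absorption zero    (suc k) = trans
  (cong₂ (λ a b → suc (suc k) * a + suc k * b) (zeroC (suc k)) (zeroC k))
  (cong₂ _+_ (*-zeroʳ k) (*-zeroʳ k))
  where
  zeroC : ∀ k → 0 C suc k ≡ 0
  zeroC k = k>n⇒nCk≡0 {0} {suc k} (s≤s z≤n)
C-absorption (suc n) zero    = begin-equality
  1 * (suc n C 1) + 0  ≡⟨ +-identityʳ _ ⟩
  1 * (suc n C 1)      ≡⟨ *-identityˡ _ ⟩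
  suc n C 1            ≡⟨ nC1≡n (suc n) ⟩
  suc n                ≡⟨ *-identityʳ (suc n) ⟨
  suc n * 1            ≡⟨ cong (suc n *_) (nC0≡1 (suc n)) ⟨
  suc n * (suc n C 0)  ∎
C-absorption (suc n) (suc k) = begin-equality
  suc (suc k) * (suc n C suc (suc k)) + suc k * (suc n C suc k)
    ≡⟨ cong₂ (λ a b → suc (suc k) * a + suc k * b) (nCk+nC[k+1]≡[n+1]C[k+1] n (suc k)) (nCk+nC[k+1]≡[n+1]C[k+1] n k) ⟨
  suc (suc k) * (b + c) + suc k * (a + b)
    ≡⟨ lemma₁ k a b c ⟩
  (suc (suc k) * c + suc k * b) + (suc k * b + k * a) + (a + b)
    ≡⟨ cong₂ (λ x y → x + y + (a + b)) (C-absorption n (suc k)) (C-absorption n k) ⟩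
  n * b + n * a + (a + b)
    ≡⟨ lemma₂ n a b ⟩
  suc n * (a + b)
    ≡⟨ cong (suc n *_) (nCk+nC[k+1]≡[n+1]C[k+1] n k) ⟩
  suc n * (suc n C suc k) ∎
  where
  a = n C k
  b = n C suc k
  c = n C suc (suc k)
  lemma₁ : ∀ k a b c → suc (suc k) * (b + c) + suc k * (a + b) ≡
                       (suc (suc k) * c + suc k * b) + (suc k * b + k * a) + (a + b)
  lemma₁ = solve-∀
  lemma₂ : ∀ n a b → n * b + n * a + (a + b) ≡ suc n * (a + b)
  lemma₂ = solve-∀

-- The recursion is Pascal's rule, so that the counts below follow by induction on the ground set,
-- according to whether a set contains its first element.
subsetsOfSize : ∀ n → ℕ → List (Subset n)
subsetsOfSize zero    zero    = [] ∷ []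
subsetsOfSize zero    (suc k) = []
subsetsOfSize (suc n) zero    = map (false ∷_) (subsetsOfSize n zero)
subsetsOfSize (suc n) (suc k) = map (true ∷_) (subsetsOfSize n k) ++ map (false ∷_) (subsetsOfSize n (suc k))

subsetsOfSize-size : ∀ n k → All (λ X → ∣ X ∣ ≡ k) (subsetsOfSize n k)
subsetsOfSize-size zero    zero    = refl ∷ []
subsetsOfSize-size zero    (suc k) = []
subsetsOfSize-size (suc n) zero    = All.map⁺ (subsetsOfSize-size n zero)
subsetsOfSize-size (suc n) (suc k) =
  All.++⁺ (All.map⁺ (All.map (cong suc) (subsetsOfSize-size n k))) (All.map⁺ (subsetsOfSize-size n (suc k)))

∈-subsetsOfSize : (X : Subset n) → ∣ X ∣ ≡ k → X List.∈ subsetsOfSize n k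
∈-subsetsOfSize {k = zero}  []          _    = here refl
∈-subsetsOfSize {k = zero}  (false ∷ X) ∣X∣  = ∈-map⁺ (false ∷_) (∈-subsetsOfSize X ∣X∣)
∈-subsetsOfSize {k = suc k} (true ∷ X)  ∣X∣  = ∈-++⁺ˡ (∈-map⁺ (true ∷_) (∈-subsetsOfSize X (suc-injective ∣X∣)))
∈-subsetsOfSize {k = suc k} (false ∷ X) ∣X∣  = ∈-++⁺ʳ (map (true ∷_) (subsetsOfSize _ k)) (∈-map⁺ (false ∷_) (∈-subsetsOfSize X ∣X∣))

subsetsOfSize-unique : ∀ n k → Unique (subsetsOfSize n k)
subsetsOfSize-unique zero    zero    = [] ∷ []
subsetsOfSize-unique zero    (suc k) = []
subsetsOfSize-unique (suc n) zero    = Unique.map⁺ (λ { refl → refl }) (subsetsOfSize-unique n zero)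
subsetsOfSize-unique (suc n) (suc k) = Unique.++⁺
  (Unique.map⁺ (λ { refl → refl }) (subsetsOfSize-unique n k))
  (Unique.map⁺ (λ { refl → refl }) (subsetsOfSize-unique n (suc k)))
  disjoint
  where
  disjoint : Disjoint (map (true ∷_) (subsetsOfSize n k)) (map (false ∷_) (subsetsOfSize n (suc k)))
  disjoint (p , q) with _ , _ , refl ← ∈-map⁻ (true ∷_) p with _ , _ , () ← ∈-map⁻ (false ∷_) q

length-subsetsOfSize : ∀ n k → length (subsetsOfSize n k) ≡ n C k
length-subsetsOfSize zero    zero    = sym (nC0≡1 0)
length-subsetsOfSize zero    (suc k) = sym (k>n⇒nCk≡0 {0} {suc k} (s≤s z≤n))
length-subsetsOfSize (suc n) zero    = trans (length-map _ (subsetsOfSize n zero))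
  (trans (length-subsetsOfSize n zero) (trans (nC0≡1 n) (sym (nC0≡1 (suc n)))))
length-subsetsOfSize (suc n) (suc k) = begin-equality
  length (map (true ∷_) xs ++ map (false ∷_) ys)          ≡⟨ length-++ (map (true ∷_) xs) ⟩
  length (map (true ∷_) xs) + length (map (false ∷_) ys)  ≡⟨ cong₂ _+_ (length-map _ xs) (length-map _ ys) ⟩
  length xs + length ys                                   ≡⟨ cong₂ _+_ (length-subsetsOfSize n k) (length-subsetsOfSize n (suc k)) ⟩
  n C k + n C suc k                                       ≡⟨ nCk+nC[k+1]≡[n+1]C[k+1] n k ⟩
  suc n C suc k                                           ∎
  where
  xs = subsetsOfSize n k
  ys = subsetsOfSize n (suc k)

count : ∀ {A : Set} {P : A → Set} → Decidable P → List A → ℕ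
count P? xs = length (filter P? xs)

module _ {A B : Set} {P : B → Set} (P? : Decidable P) (f : A → B) where

  count-map : ∀ {Q : A → Set} (Q? : Decidable Q) → (∀ {x} → P (f x) → Q x) → (∀ {x} → Q x → P (f x)) →
              ∀ xs → count P? (map f xs) ≡ count Q? xs
  count-map Q? to from xs = trans (pull xs) (cong length (filter-≐ (P? ∘ f) Q? (to , from) xs))
    where
    pull : ∀ xs → count P? (map f xs) ≡ count (P? ∘ f) xs
    pull []       = refl
    pull (x ∷ xs) with does (P? (f x))
    ... | true  = cong suc (pull xs)
    ... | false = pull xs

  count-map-none : ∀ {xs} → All (λ x → ¬ P (f x)) xs → count P? (map f xs) ≡ 0
  count-map-none none = cong length (filter-none P? (All.map⁺ none))

count-++ : ∀ {A : Set} {P : A → Set} (P? : Decidable P) xs ys → count P? (xs ++ ys) ≡ count P? xs + count P? ys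
count-++ P? xs ys = trans (cong length (filter-++ P? xs ys)) (length-++ (filter P? xs))

count-by-head : ∀ {P : Subset (suc n) → Set} (P? : Decidable P) k {a b} →
                count P? (map (true ∷_) (subsetsOfSize n k)) ≡ a →
                count P? (map (false ∷_) (subsetsOfSize n (suc k))) ≡ b →
                count P? (subsetsOfSize (suc n) (suc k)) ≡ a + b
count-by-head {n} P? k at-true at-false =
  trans (count-++ P? (map (true ∷_) (subsetsOfSize n k)) _) (cong₂ _+_ at-true at-false)

true∷⊈false∷ : ∀ {X Y : Subset n} → ¬ (true ∷ X) ⊆ (false ∷ Y)
true∷⊈false∷ sub with () ← sub here

count-⊆ : ∀ (X : Subset n) k → count (_⊆? X) (subsetsOfSize n k) ≡ ∣ X ∣ C k
count-⊆ []          zero    = sym (nC0≡1 0)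
count-⊆ []          (suc k) = sym (k>n⇒nCk≡0 {0} {suc k} (s≤s z≤n))
count-⊆ {suc n} (b ∷ X) zero = begin-equality
  count (_⊆? b ∷ X) (map (false ∷_) Ys)  ≡⟨ count-map (_⊆? b ∷ X) (false ∷_) (_⊆? X) drop-∷-⊆ out⊆ Ys ⟩
  count (_⊆? X) Ys                       ≡⟨ count-⊆ X zero ⟩
  ∣ X ∣ C 0                              ≡⟨ nC0≡1 ∣ X ∣ ⟩
  1                                      ≡⟨ nC0≡1 ∣ b ∷ X ∣ ⟨
  ∣ b ∷ X ∣ C 0                          ∎
  where
  Ys = subsetsOfSize n zero
count-⊆ {suc n} (true ∷ X) (suc k) = trans
  (count-by-head (_⊆? true ∷ X) k
    (trans (count-map (_⊆? true ∷ X) (true ∷_) (_⊆? X) drop-∷-⊆ in⊆in (subsetsOfSize n k))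
           (count-⊆ X k))
    (trans (count-map (_⊆? true ∷ X) (false ∷_) (_⊆? X) drop-∷-⊆ out⊆ (subsetsOfSize n (suc k)))
           (count-⊆ X (suc k))))
  (nCk+nC[k+1]≡[n+1]C[k+1] ∣ X ∣ k)
count-⊆ {suc n} (false ∷ X) (suc k) = count-by-head (_⊆? false ∷ X) k
  (count-map-none (_⊆? false ∷ X) (true ∷_) (All.universal (λ _ → true∷⊈false∷) (subsetsOfSize n k)))
  (trans (count-map (_⊆? false ∷ X) (false ∷_) (_⊆? X) drop-∷-⊆ out⊆ (subsetsOfSize n (suc k)))
         (count-⊆ X (suc k)))

count-⊇-same-size : ∀ (Y : Subset n) → ∣ Y ∣ ≡ k → count (Y ⊆?_) (subsetsOfSize n k) ≡ 1
count-⊇-same-size {zero} {zero} [] _ = refl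
count-⊇-same-size {suc n} {zero} (false ∷ Y) ∣Y∣ = trans
  (count-map (false ∷ Y ⊆?_) (false ∷_) (Y ⊆?_) drop-∷-⊆ out⊆ (subsetsOfSize n zero))
  (count-⊇-same-size Y ∣Y∣)
count-⊇-same-size {suc n} {suc k} (true ∷ Y) ∣Y∣ = count-by-head (true ∷ Y ⊆?_) k
  (trans (count-map (true ∷ Y ⊆?_) (true ∷_) (Y ⊆?_) drop-∷-⊆ in⊆in (subsetsOfSize n k))
         (count-⊇-same-size Y (suc-injective ∣Y∣)))
  (count-map-none (true ∷ Y ⊆?_) (false ∷_) (All.universal (λ _ → true∷⊈false∷) (subsetsOfSize n (suc k))))
count-⊇-same-size {suc n} {suc k} (false ∷ Y) ∣Y∣ = count-by-head (false ∷ Y ⊆?_) k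
  (count-map-none (false ∷ Y ⊆?_) (true ∷_) (All.map too-small (subsetsOfSize-size n k)))
  (trans (count-map (false ∷ Y ⊆?_) (false ∷_) (Y ⊆?_) drop-∷-⊆ out⊆ (subsetsOfSize n (suc k)))
         (count-⊇-same-size Y ∣Y∣))
  where
  too-small : ∀ {X} → ∣ X ∣ ≡ k → ¬ (false ∷ Y) ⊆ (true ∷ X)
  too-small ∣X∣ sub = n≮n k (subst₂ _≤_ ∣Y∣ ∣X∣ (p⊆q⇒∣p∣≤∣q∣ (drop-∷-⊆ sub)))

-- The added element ranges over the complement of `Y`; the term `k` on the left avoids subtraction.
-- If `Y` misses the first element, adding that one gives exactly one set, which is where the
-- same-size count enters.
count-⊇-suc : ∀ (Y : Subset n) → ∣ Y ∣ ≡ k → count (Y ⊆?_) (subsetsOfSize n (suc k)) + k ≡ n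
count-⊇-suc {zero} {zero} [] _ = refl
count-⊇-suc {suc n} {suc k} (true ∷ Y) ∣Y∣ = begin-equality
  count (true ∷ Y ⊆?_) (subsetsOfSize (suc n) (suc (suc k))) + suc k
    ≡⟨ cong (_+ suc k) (count-by-head (true ∷ Y ⊆?_) (suc k)
         (count-map (true ∷ Y ⊆?_) (true ∷_) (Y ⊆?_) drop-∷-⊆ in⊆in (subsetsOfSize n (suc k)))
         (count-map-none (true ∷ Y ⊆?_) (false ∷_) (All.universal (λ _ → true∷⊈false∷) (subsetsOfSize n (suc (suc k)))))) ⟩
  count (Y ⊆?_) Xs + 0 + suc k  ≡⟨ cong (_+ suc k) (+-identityʳ (count (Y ⊆?_) Xs)) ⟩
  count (Y ⊆?_) Xs + suc k      ≡⟨ +-suc _ k ⟩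
  suc (count (Y ⊆?_) Xs + k)    ≡⟨ cong suc (count-⊇-suc Y (suc-injective ∣Y∣)) ⟩
  suc n                         ∎
  where
  Xs = subsetsOfSize n (suc k)
count-⊇-suc {suc n} {k} (false ∷ Y) ∣Y∣ = trans
  (cong (_+ k) (count-by-head (false ∷ Y ⊆?_) k
    (trans (count-map (false ∷ Y ⊆?_) (true ∷_) (Y ⊆?_) drop-∷-⊆ out⊆ (subsetsOfSize n k))
           (count-⊇-same-size Y ∣Y∣))
    (count-map (false ∷ Y ⊆?_) (false ∷_) (Y ⊆?_) drop-∷-⊆ out⊆ (subsetsOfSize n (suc k)))))
  (cong suc (count-⊇-suc Y ∣Y∣))

-- Sparse paving matroids

⊈⇒∃∉ : ∀ {p q : Subset n} → ¬ p ⊆ q → ∃ λ x → x ∈ p × x ∉ q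
⊈⇒∃∉ {p = p} {q} p⊈q with any? (λ x → x ∈? p ×-dec ¬? (x ∈? q))
... | yes found = found
... | no  none  = contradiction (λ {x} x∈p → decidable-stable (x ∈? q) (λ x∉q → none (x , x∈p , x∉q))) p⊈q

⊆∧∣∣≥⇒≡ : ∀ {p q : Subset n} → p ⊆ q → ∣ q ∣ ≤ ∣ p ∣ → p ≡ q
⊆∧∣∣≥⇒≡ {p = p} {q} p⊆q ∣q∣≤∣p∣ with q ⊆? p
... | yes q⊆p = ⊆-antisym p⊆q q⊆p
... | no  q⊈p = contradiction (p⊂q⇒∣p∣<∣q∣ (p⊆q , ⊈⇒∃∉ q⊈p)) (≤⇒≯ ∣q∣≤∣p∣)

∣p∪⁅x⁆∣ : ∀ {p : Subset n} {x} → x ∉ p → ∣ p ∪ ⁅ x ⁆ ∣ ≡ suc ∣ p ∣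
∣p∪⁅x⁆∣ {p = true  ∷ p} {zero}  x∉p = contradiction here x∉p
∣p∪⁅x⁆∣ {p = false ∷ p} {zero}  x∉p = cong (suc ∘ ∣_∣) (∪-identityʳ p)
∣p∪⁅x⁆∣ {p = true  ∷ p} {suc x} x∉p = cong suc (∣p∪⁅x⁆∣ (x∉p ∘ there))
∣p∪⁅x⁆∣ {p = false ∷ p} {suc x} x∉p = ∣p∪⁅x⁆∣ (x∉p ∘ there)

∣p-x∣ : ∀ {p : Subset n} {x} → x ∈ p → suc ∣ p - x ∣ ≡ ∣ p ∣
∣p-x∣ {p = true  ∷ p} here        = cong (suc ∘ ∣_∣) (p─⊥≡p p)
∣p-x∣ {p = true  ∷ p} (there x∈p) = cong suc (∣p-x∣ x∈p)
∣p-x∣ {p = false ∷ p} (there x∈p) = ∣p-x∣ x∈p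

x∉p-x : ∀ (p : Subset n) x → x ∉ p - x
x∉p-x (true  ∷ p) (suc x) (there x∈) = x∉p-x p x x∈
x∉p-x (false ∷ p) (suc x) (there x∈) = x∉p-x p x x∈

p∪⁅x⁆-x≡p : ∀ {p : Subset n} {x} → x ∉ p → (p ∪ ⁅ x ⁆) - x ≡ p
p∪⁅x⁆-x≡p {p = true  ∷ p} {zero}  x∉p = contradiction here x∉p
p∪⁅x⁆-x≡p {p = false ∷ p} {zero}  x∉p = cong (false ∷_) (trans (p─⊥≡p _) (∪-identityʳ p))
p∪⁅x⁆-x≡p {p = true  ∷ p} {suc x} x∉p = cong (true ∷_) (p∪⁅x⁆-x≡p (x∉p ∘ there))
p∪⁅x⁆-x≡p {p = false ∷ p} {suc x} x∉p = cong (false ∷_) (p∪⁅x⁆-x≡p (x∉p ∘ there))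

x∈p∪⁅y⁆⁻ : ∀ {p : Subset n} {x y} → x ∈ p ∪ ⁅ y ⁆ → x ∈ p ⊎ x ≡ y
x∈p∪⁅y⁆⁻ {p = p} {y = y} x∈ with x∈p∪q⁻ p ⁅ y ⁆ x∈
... | inj₁ x∈p = inj₁ x∈p
... | inj₂ x∈y = inj₂ (x∈⁅y⁆⇒x≡y y x∈y)

x∈p∪⁅x⁆ : ∀ {p : Subset n} {x} → x ∈ p ∪ ⁅ x ⁆
x∈p∪⁅x⁆ {x = x} = x∈p∪q⁺ (inj₂ (x∈⁅x⁆ x))

p⊆q⇒p∪⁅x⁆⊆q : ∀ {p q : Subset n} {x} → p ⊆ q → x ∈ q → p ∪ ⁅ x ⁆ ⊆ q
p⊆q⇒p∪⁅x⁆⊆q p⊆q x∈q z∈ with x∈p∪⁅y⁆⁻ z∈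
... | inj₁ z∈p  = p⊆q z∈p
... | inj₂ refl = x∈q

covers : ∀ {p q : Subset n} → p ⊆ q → ∣ q ∣ ≡ suc ∣ p ∣ → ∃ λ x → x ∉ p × q ≡ p ∪ ⁅ x ⁆
covers {p = p} {q} p⊆q ∣q∣≡ with ⊈⇒∃∉ {p = q} {p} (λ q⊆p → 1+n≰n (subst (_≤ ∣ p ∣) ∣q∣≡ (p⊆q⇒∣p∣≤∣q∣ q⊆p)))
... | x , x∈q , x∉p = x , x∉p ,
  sym (⊆∧∣∣≥⇒≡ (p⊆q⇒p∪⁅x⁆⊆q p⊆q x∈q) (≤-reflexive (trans ∣q∣≡ (sym (∣p∪⁅x⁆∣ x∉p)))))

∈-subsets : ∀ (X : Subset n) → X List.∈ subsets n
∈-subsets []          = here refl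
∈-subsets (false ∷ X) = ∈-++⁺ˡ (∈-map⁺ (false ∷_) (∈-subsets X))
∈-subsets (true ∷ X)  = ∈-++⁺ʳ (map (false ∷_) (subsets _)) (∈-map⁺ (true ∷_) (∈-subsets X))

-- Basis exchange and rank.

module _ {n : ℕ} (𝓑 : Family n) where

  -- Exchanging an element of `A` outside `B` keeps the size and shrinks the part of `A` outside
  -- `B`. Once that part is empty, an element of `B` outside `A` would have no exchange partner.
  basis-equicardinal : Exchange 𝓑 → ∀ {A B} → Basis 𝓑 A → Basis 𝓑 B → ∣ A ∣ ≡ ∣ B ∣
  basis-equicardinal exchange {A} {B} bA bB = go (suc ∣ A ∩ ∁ B ∣) A bA ≤-refl
    where
    go : ∀ d A → Basis 𝓑 A → ∣ A ∩ ∁ B ∣ < d → ∣ A ∣ ≡ ∣ B ∣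
    go (suc d) A bA lt with A ⊆? B
    ... | yes A⊆B with B ⊆? A
    ...   | yes B⊆A = cong ∣_∣ (⊆-antisym A⊆B B⊆A)
    ...   | no  B⊈A with x , x∈B , x∉A ← ⊈⇒∃∉ B⊈A
                    with y , y∈A , y∉B , _ ← exchange B A bB bA x x∈B x∉A = contradiction (A⊆B y∈A) y∉B
    go (suc d) A bA lt | no A⊈B
      with x , x∈A , x∉B ← ⊈⇒∃∉ A⊈B
      with y , y∈B , y∉A , bA′ ← exchange A B bA bB x x∈A x∉B
      = trans (sym ∣A′∣) (go d A′ bA′ (<-≤-trans (p⊂q⇒∣p∣<∣q∣ shrinks) (s≤s⁻¹ lt)))
      where
      A′ = (A - x) ∪ ⁅ y ⁆
      ∣A′∣ : ∣ A′ ∣ ≡ ∣ A ∣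
      ∣A′∣ = trans (∣p∪⁅x⁆∣ (y∉A ∘ p─q⊆p A ⁅ x ⁆)) (∣p-x∣ x∈A)
      shrinks : A′ ∩ ∁ B ⊂ A ∩ ∁ B
      shrinks = sub , x , x∈p∩q⁺ (x∈A , x∉p⇒x∈∁p x∉B) , x∉A′ ∘ proj₁ ∘ x∈p∩q⁻ A′ (∁ B)
        where
        sub : A′ ∩ ∁ B ⊆ A ∩ ∁ B
        sub z∈ with z∈A′ , z∈∁B ← x∈p∩q⁻ A′ (∁ B) z∈ with x∈p∪⁅y⁆⁻ z∈A′
        ... | inj₁ z∈A-x = x∈p∩q⁺ (p─q⊆p A ⁅ x ⁆ z∈A-x , z∈∁B)
        ... | inj₂ refl  = contradiction y∈B (x∈∁p⇒x∉p z∈∁B)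
        x∉A′ : x ∉ A′
        x∉A′ x∈A′ with x∈p∪⁅y⁆⁻ x∈A′
        ... | inj₁ x∈A-x = x∉p-x A x x∈A-x
        ... | inj₂ refl  = x∉B y∈B

  ∣independent∣≤rank : ∀ {I X} → Independent 𝓑 I → I ⊆ X → ∣ I ∣ ≤ rank 𝓑 X
  ∣independent∣≤rank {I} {X} indep I⊆X = All.lookup (xs≤max 0 _)
    (∈-map⁺ ∣_∣ (∈-filter⁺ (λ I → independent? 𝓑 I ×-dec I ⊆? X) (∈-subsets I) (indep , I⊆X)))

  -- A positive maximum cannot be the default value 0 of `max`, so it is the size of a listed
  -- independent set.
  rank-attained : ∀ X → 0 < rank 𝓑 X → ∃ λ I → Independent 𝓑 I × I ⊆ X × rank 𝓑 X ≡ ∣ I ∣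
  rank-attained X 0<rank with argmax-sel id 0 (map ∣_∣ (filter (λ I → independent? 𝓑 I ×-dec I ⊆? X) (subsets n)))
  ... | inj₁ rank≡0 = contradiction rank≡0 (>⇒≢ 0<rank)
  ... | inj₂ rank∈ with I , I∈ , rank≡ ← ∈-map⁻ ∣_∣ rank∈
                   with _ , indep , I⊆X ← ∈-filter⁻ (λ I → independent? 𝓑 I ×-dec I ⊆? X) {xs = subsets n} I∈
    = I , indep , I⊆X , rank≡

  rank-⊤ : Exchange 𝓑 → ∀ {B} → Basis 𝓑 B → rank 𝓑 ⊤ ≡ ∣ B ∣
  rank-⊤ exchange {B} bB = ≤-antisym le (∣independent∣≤rank (B , bB , id) ⊆⊤)
    where
    le : rank 𝓑 ⊤ ≤ ∣ B ∣
    le with rank 𝓑 ⊤ in eq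
    ... | zero  = z≤n
    ... | suc m with I , (B′ , bB′ , I⊆B′) , _ , rank≡ ← rank-attained ⊤ (subst (0 <_) (sym eq) z<s) = begin
      suc m     ≡⟨ trans (sym eq) rank≡ ⟩
      ∣ I ∣     ≤⟨ p⊆q⇒∣p∣≤∣q∣ I⊆B′ ⟩
      ∣ B′ ∣    ≡⟨ basis-equicardinal exchange bB′ bB ⟩
      ∣ B ∣     ∎

  -- Non-bases of a sparse paving matroid.

  module _ (sp : IsSparsePaving 𝓑 r) where

    private
      exchange = proj₂ (proj₁ sp)

    sparsePaving-basis-size : ∀ {B} → Basis 𝓑 B → ∣ B ∣ ≡ r
    sparsePaving-basis-size bB = trans (sym (rank-⊤ exchange bB)) (proj₁ (proj₂ sp))

    nonbasis : ∀ {X} → ∣ X ∣ ≡ r → ¬ Basis 𝓑 X → Circuit 𝓑 X × Hyperplane 𝓑 X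
    nonbasis ∣X∣ ¬bX with proj₂ (proj₂ sp) _ ∣X∣
    ... | inj₁ bX = contradiction bX ¬bX
    ... | inj₂ ch = ch

    nonbases-separated : ∀ {Y X X′} → Y ⊆ X → Y ⊆ X′ → r ≡ suc ∣ Y ∣ → ∣ X ∣ ≡ r → ∣ X′ ∣ ≡ r →
                         ¬ Basis 𝓑 X → ¬ Basis 𝓑 X′ → X ≡ X′
    nonbases-separated {Y} {X} {X′} Y⊆X Y⊆X′ r≡ ∣X∣ ∣X′∣ ¬bX ¬bX′
      with x , x∉Y , refl ← covers Y⊆X (trans ∣X∣ r≡)
      with x′ , x′∉Y , refl ← covers Y⊆X′ (trans ∣X′∣ r≡)
      with x′ ∈? X
    ... | yes x′∈X = [ (λ x′∈Y → contradiction x′∈Y x′∉Y) , (λ { refl → refl }) ]′ (x∈p∪⁅y⁆⁻ x′∈X)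
    ... | no  x′∉X
      with circuit , flat , rankX ← nonbasis ∣X∣ ¬bX
      -- `Y` is a proper subset of the circuit `X`, hence independent.
      with B₀ , bB₀ , Y⊆B₀ ← proj₂ circuit Y (Y⊆X , x , x∈p∪⁅x⁆ {p = Y} , x∉Y)
      with w , w∉Y , refl ← covers Y⊆B₀ (trans (sparsePaving-basis-size bB₀) r≡)
      with I , (B , bB , I⊆B) , I⊆ , rank≡ ← rank-attained (X ∪ ⁅ x′ ⁆) (≤-<-trans z≤n (flat x′ x′∉X))
      = conclude
      where
      -- The hyperplane `X` is one short of full rank and gains rank with `x′`, so `I` is as large
      -- as a basis and equals the `B` around it.
      B⊆ : B ⊆ X ∪ ⁅ x′ ⁆
      B⊆ = subst (_⊆ X ∪ ⁅ x′ ⁆) (⊆∧∣∣≥⇒≡ I⊆B (begin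
        ∣ B ∣                  ≡⟨ rank-⊤ exchange bB ⟨
        rank 𝓑 ⊤               ≡⟨ rankX ⟨
        suc (rank 𝓑 X)         ≤⟨ flat x′ x′∉X ⟩
        rank 𝓑 (X ∪ ⁅ x′ ⁆)    ≡⟨ rank≡ ⟩
        ∣ I ∣                  ∎)) I⊆
      -- Outside `Y` the set `B` can contain only `x` and `x′`, and adding either to `Y` gives `X`
      -- or `X′`.
      nonbasis-through : ∀ {z} → z ∉ Y → z ∈ B → ¬ Basis 𝓑 (Y ∪ ⁅ z ⁆)
      nonbasis-through z∉Y z∈B bYz with x∈p∪⁅y⁆⁻ {p = X} (B⊆ z∈B)
      ... | inj₂ refl = ¬bX′ bYz
      ... | inj₁ z∈X with x∈p∪⁅y⁆⁻ {p = Y} z∈X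
      ...   | inj₁ z∈Y  = z∉Y z∈Y
      ...   | inj₂ refl = ¬bX bYz
      conclude : X ≡ X′
      conclude with w ∈? B
      ... | yes w∈B = contradiction bB₀ (nonbasis-through w∉Y w∈B)
      -- Removing `w` from the basis leaves `Y`, so the exchange makes `Y ∪ ⁅ y ⁆` a basis with `y`
      -- in `B`.
      ... | no  w∉B with y , y∈B , y∉B₀ , bY ← exchange (Y ∪ ⁅ w ⁆) B bB₀ bB w (x∈p∪⁅x⁆ {p = Y}) w∉B =
        contradiction (subst (λ Z → Basis 𝓑 (Z ∪ ⁅ y ⁆)) (p∪⁅x⁆-x≡p w∉Y) bY)
                      (nonbasis-through (y∉B₀ ∘ Y⊆B₀) y∈B)

-- Counting sparse paving matroids

families-unique : ∀ n → Setoid.Unique (Subset n →-setoid Bool) (families n)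
families-unique zero    = ((λ eq → contradiction (eq []) λ ()) ∷ []) ∷ [] ∷ []
families-unique (suc n) = Setoid.cartesianProductWith⁺
  (Subset n →-setoid Bool) (Subset n →-setoid Bool) (Subset (suc n) →-setoid Bool) glue
  (λ eq → (λ X → eq (false ∷ X)) , (λ X → eq (true ∷ X)))
  (families-unique n) (families-unique n)

¬T⇒≡false : ∀ {b} → ¬ T b → b ≡ false
¬T⇒≡false {false} _  = refl
¬T⇒≡false {true}  ¬T = contradiction _ ¬T

≡false⇒¬T : ∀ {b} → b ≡ false → ¬ T b
≡false⇒¬T refl ()

module _ (n r : ℕ) where

  sparsePavings : List (Family n)
  sparsePavings = filter (λ 𝓑 → isSparsePaving? 𝓑 r) (families n)

  sparsePavings-sound : All (λ 𝓑 → IsSparsePaving 𝓑 r) sparsePavings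
  sparsePavings-sound = all-filter (λ 𝓑 → isSparsePaving? 𝓑 r) (families n)

  -- All bases have size `r`, so agreement on the r-sets is agreement everywhere, which the
  -- uniqueness of `families` up to pointwise equality excludes.
  sparsePavings-distinct : AllPairs (λ f g → ¬ All (λ X → f X ≡ g X) (subsetsOfSize n r)) sparsePavings
  sparsePavings-distinct = AllPairs.zipWith
    (λ ((spf , spg) , f≢g) agree → f≢g (ext spf spg agree))
    (All⇒AllPairs sparsePavings-sound , AllPairs.filter⁺ (λ 𝓑 → isSparsePaving? 𝓑 r) (families-unique n))
    where
    ext : ∀ {f g} → IsSparsePaving f r → IsSparsePaving g r →
          All (λ X → f X ≡ g X) (subsetsOfSize n r) → ∀ X → f X ≡ g X
    ext {f} {g} spf spg agree X with ∣ X ∣ ≟ r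
    ... | yes ∣X∣ = All.lookup agree (∈-subsetsOfSize X ∣X∣)
    ... | no  ∣X∣ = trans (¬T⇒≡false (∣X∣ ∘ sparsePaving-basis-size f spf))
                          (sym (¬T⇒≡false (∣X∣ ∘ sparsePaving-basis-size g spg)))

s-suc-bound : ∀ n k → suc k ≤ n → s n (suc k) ^ suc k ≤ (n ∸ suc k + 2) ^ (n C k)
s-suc-bound n k k<n = begin
  length F ^ suc k            ≤⟨ ^-monoˡ-≤ (suc k) (length≤traces I (sparsePavings-distinct n (suc k))) ⟩
  traces I F ^ suc k          ≤⟨ shearer _⊆?_ Ys (suc k) I (All.map degree (subsetsOfSize-size n (suc k))) F ⟩
  prod (λ Y → traces (filter (Y ⊆?_) I) F) Ys
                              ≤⟨ prod-mono (All.map clique (subsetsOfSize-size n k)) ⟩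
  prod (λ _ → c) Ys           ≡⟨ prod-const c Ys ⟩
  c ^ length Ys               ≡⟨ cong (c ^_) (length-subsetsOfSize n k) ⟩
  c ^ (n C k)                 ∎
  where
  F = sparsePavings n (suc k)
  I = subsetsOfSize n (suc k)
  Ys = subsetsOfSize n k
  c = n ∸ suc k + 2
  degree : ∀ {X} → ∣ X ∣ ≡ suc k → length (filter (_⊆? X) Ys) ≡ suc k
  degree {X} ∣X∣ = begin-equality
    length (filter (_⊆? X) Ys)  ≡⟨ count-⊆ X k ⟩
    ∣ X ∣ C k                   ≡⟨ cong (_C k) ∣X∣ ⟩
    suc k C k                   ≡⟨ nCk≡nC[n∸k] (n≤1+n k) ⟩
    suc k C (suc k ∸ k)         ≡⟨ cong (suc k C_) (m+n∸n≡m 1 k) ⟩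
    suc k C 1                   ≡⟨ nC1≡n (suc k) ⟩
    suc k                       ∎
  -- The sets of size k + 1 above `Y` form a clique of the Johnson graph, in which the non-bases are
  -- an independent set.
  clique : ∀ {Y} → ∣ Y ∣ ≡ k → traces (filter (Y ⊆?_) I) F ≤ c
  clique {Y} ∣Y∣ = begin
    traces A F                  ≤⟨ traces≤suc-length A (All.map stable (sparsePavings-sound n (suc k))) ⟩
    -- There are n - k = (n - (k + 1)) + 1 sets above `Y`; the pattern without non-bases adds one
    -- more, whence the 2 in `c`.
    suc (length A)              ≡⟨ cong suc (+-cancelʳ-≡ k _ _ (trans (count-⊇-suc Y ∣Y∣) size)) ⟩
    suc (n ∸ suc k + 1)         ≡⟨ +-suc (n ∸ suc k) 1 ⟨
    c                           ∎
    where
    A = filter (Y ⊆?_) I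
    size : n ≡ n ∸ suc k + 1 + k
    size = trans (sym (m∸n+n≡m k<n)) (sym (+-assoc (n ∸ suc k) 1 k))
    members : All (λ X → Y ⊆ X × ∣ X ∣ ≡ suc k) A
    members = All.zip (all-filter (Y ⊆?_) I , All.filter⁺ (Y ⊆?_) (subsetsOfSize-size n (suc k)))
    stable : ∀ {f} → IsSparsePaving f (suc k) → AllPairs (λ X X′ → f X ≡ false → f X′ ≡ true) A
    stable {f} sp = AllPairs.zipWith
      (λ (((Y⊆X , ∣X∣) , (Y⊆X′ , ∣X′∣)) , X≢X′) fX → ¬-not λ fX′ →
        X≢X′ (nonbases-separated f sp Y⊆X Y⊆X′ (cong suc (sym ∣Y∣)) ∣X∣ ∣X′∣ (≡false⇒¬T fX) (≡false⇒¬T fX′)))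
      (All⇒AllPairs members , Unique.filter⁺ (Y ⊆?_) (subsetsOfSize-unique n (suc k)))

-- Some basis exists and has size 0, so the empty set, the only coordinate, is a basis in every such
-- matroid.
s-zero-bound : ∀ n → s n 0 ≤ 1
s-zero-bound n = ≤-trans (length≤traces (subsetsOfSize n 0) (sparsePavings-distinct n 0))
  (traces≤1 _ (All.map (λ sp → All.map (empty-basis sp) (subsetsOfSize-size n 0)) (sparsePavings-sound n 0)))
  where
  empty-basis : ∀ {f} → IsSparsePaving f 0 → ∀ {X} → ∣ X ∣ ≡ 0 → f X ≡ true
  empty-basis {f} sp@(((B , bB) , _) , _) {X} ∣X∣ = trans (cong f X≡B) (Equivalence.to T-≡ bB)
    where
    empty : ∀ {p : Subset n} → ∣ p ∣ ≡ 0 → ⊥ ≡ p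
    empty ∣p∣ = ⊆∧∣∣≥⇒≡ (⊆-min _) (≤-trans (≤-reflexive ∣p∣) z≤n)
    X≡B : X ≡ B
    X≡B = trans (sym (empty ∣X∣)) (empty (sparsePaving-basis-size f sp bB))

s-bound : ∀ n r → r ≤ n → s n r ^ suc (n ∸ r) ≤ (n ∸ r + 2) ^ (n C r)
s-bound n zero    _   = begin
  s n 0 ^ suc n        ≤⟨ ^-monoˡ-≤ (suc n) (s-zero-bound n) ⟩
  1 ^ suc n            ≡⟨ ^-zeroˡ (suc n) ⟩
  1                    ≤⟨ ≤-trans (s≤s z≤n) (m≤n+m 2 n) ⟩
  n + 2                ≡⟨ ^-identityʳ (n + 2) ⟨
  (n + 2) ^ 1          ≡⟨ cong ((n + 2) ^_) (nC0≡1 n) ⟨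
  (n + 2) ^ (n C 0)    ∎
-- Shearer's bound controls the r-th power with r = k + 1. Both sides are compared after raising to
-- that power, which keeps the exponents integral, and the root is taken by cancellation.
s-bound n (suc k) k<n = ^-cancelʳ-≤ (suc k) (begin
  (σ ^ suc m) ^ suc k        ≡⟨ ^-swap σ (suc m) (suc k) ⟩
  (σ ^ suc k) ^ suc m        ≤⟨ ^-monoˡ-≤ (suc m) (s-suc-bound n k k<n) ⟩
  (c ^ (n C k)) ^ suc m      ≡⟨ ^-*-assoc c (n C k) (suc m) ⟩
  c ^ ((n C k) * suc m)      ≡⟨ cong (c ^_) exponent ⟩
  c ^ ((n C suc k) * suc k)  ≡⟨ ^-*-assoc c (n C suc k) (suc k) ⟨
  (c ^ (n C suc k)) ^ suc k  ∎)
  where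
  σ = s n (suc k)
  m = n ∸ suc k
  c = m + 2
  lemma : ∀ m k M → (m + suc k) * M ≡ M * suc m + k * M
  lemma = solve-∀
  exponent : (n C k) * suc m ≡ (n C suc k) * suc k
  exponent = +-cancelʳ-≡ (k * (n C k)) _ _ (begin-equality
    (n C k) * suc m + k * (n C k)        ≡⟨ lemma m k (n C k) ⟨
    (m + suc k) * (n C k)                ≡⟨ cong (_* (n C k)) (m∸n+n≡m k<n) ⟩
    n * (n C k)                          ≡⟨ C-absorption n k ⟨
    suc k * (n C suc k) + k * (n C k)    ≡⟨ cong (_+ k * (n C k)) (*-comm (suc k) (n C suc k)) ⟩
    (n C suc k) * suc k + k * (n C k)    ∎)

-- From powers to logarithms.

C-nonZero : ∀ {n k} → k ≤ n → NonZero (n C k)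
C-nonZero {n} {zero} _ = subst NonZero (sym (nC0≡1 n)) _
C-nonZero {suc n} {suc k} (s≤s k≤n) = subst NonZero (nCk+nC[k+1]≡[n+1]C[k+1] n k)
  (>-nonZero (<-≤-trans (>-nonZero⁻¹ (n C k) {{C-nonZero k≤n}}) (m≤m+n (n C k) _)))

-- With c = N/(m + 1), every rational `p` satisfying 2^p ≤ y yields 2^(p/c) ≤ x, so dividing by `c`
-- carries the cut of `log₂ y` into that of `log₂ x`.
log₂-≤ : ∀ m N {y x} .{{_ : NonZero N}} .{{_ : NonZero x}} → y ^ suc m ≤ x ^ N →
         log₂ y ≤ʳ ((+ N) / suc m) · log₂ x
-- Both the supremum and the scaling ask for a strict inequality; the intermediate `q′` leaves a gap
-- for each.
log₂-≤ m N@(suc N-1) {y} {x} y^≤x^ q (p , 2^p≤y , q<p) with q′ , q<q′ , q′<p ← ℚᵘ.<-dense q<p =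
  1/c ℚᵘ.* q′ , (1/c ℚᵘ.* p , 2^≤ p 2^p≤y , ℚᵘ.*-monoʳ-<-pos 1/c q′<p) ,
  ℚᵘ.<-respʳ-≃ (ℚᵘ.≃-sym c*1/c*q′) q<q′
  where
  c = (+ N) / suc m
  1/c = mkℚᵘ (+ suc m) N-1
  c*1/c*q′ : c ℚᵘ.* (1/c ℚᵘ.* q′) ℚᵘ.≃ q′
  c*1/c*q′ = ℚᵘ.≃-trans (ℚᵘ.≃-sym (ℚᵘ.*-assoc c 1/c q′))
    (ℚᵘ.≃-trans (ℚᵘ.*-congʳ {q′} (ℚᵘ.*-inverseʳ c)) (ℚᵘ.*-identityˡ q′))
  2^≤ : ∀ p → 2^ p ≤ y → 2^ 1/c ℚᵘ.* p ≤ x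
  -- A negative power of 2 lies below every positive `x`.
  2^≤ (mkℚᵘ -[1+ a ] d) _ = *-mono-≤ (m^n>0 2 (suc m * suc a)) (m^n>0 x (N * suc d))
  -- `2^_≤_` matches on the sign of the numerator, so the integer product is first brought to the
  -- form `+ _`.
  2^≤ (mkℚᵘ (+ a) d) 2^a≤y^b = subst (λ z → 2^ mkℚᵘ z (d + N-1 * suc d) ≤ x) (ℤ.pos-* (suc m) a) (begin
    2 ^ (suc m * a)            ≡⟨ cong (2 ^_) (*-comm (suc m) a) ⟩
    2 ^ (a * suc m)            ≡⟨ ^-*-assoc 2 a (suc m) ⟨
    (2 ^ a) ^ suc m            ≤⟨ ^-monoˡ-≤ (suc m) 2^a≤y^b ⟩
    (y ^ suc d) ^ suc m        ≡⟨ ^-swap y (suc d) (suc m) ⟩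
    (y ^ suc m) ^ suc d        ≤⟨ ^-monoˡ-≤ (suc d) y^≤x^ ⟩
    (x ^ N) ^ suc d            ≡⟨ ^-*-assoc x N (suc d) ⟩
    x ^ (N * suc d)            ∎)

theorem1p2 : (n r : ℕ) → r ≤ n →
    log₂ (s n r) ≤ʳ ((+ (n C r)) / suc (n ∸ r)) · log₂ (n ∸ r + 2)
theorem1p2 n r r≤n = log₂-≤ (n ∸ r) (n C r)
  {{C-nonZero r≤n}} {{>-nonZero (≤-trans (s≤s z≤n) (m≤n+m 2 (n ∸ r)))}} (s-bound n r r≤n)
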